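{- (1) The slim dense near hexagon $Q(5,2)\times\mathbb{L}_3$ has a non-abelian representation in the extra-special $2$-group $2^{1+12}_+$. (2) The slim dense near hexagon $Q(5,2)\otimes Q(5,2)$ has a non-abelian representation in the extra-special $2$-group $2^{1+18}_-$.
   Context: A partial linear space $\mathcal{S}=(P,L)$ is slim if every line has exactly three points. For collinear distinct points $x,y$, write $x*y$ for the third point of the line $xy$. A representation of a slim partial linear space $\mathcal{S}=(P,L)$ is a pair $(R,\psi)$ where $R$ is a group and $\psi$ maps $P$ into the set of involutions of $R$ such that (R1) $R$ is generated by $\psi(P)$, and (R2) for every line $\{x,y,x*y\}$, $\psi$ is injective on this line and $\psi(x)\psi(y)=\psi(x*y)$. The representation is non-abelian if $R$ is non-abelian. A near polygon is a partial linear space such that for every point $p$ and line $\ell$ there is a unique point on $\ell$ nearest to $p$ (distance in the collinearity graph); it is a near hexagon if the maximal distance between points is $3$. It is dense if every line has at least three points and any two points at distance $2$ have at least two common neighbours. $Q(5,2)$ denotes the (unique up to isomorphism) generalized quadrangle of order $(2,4)$, e.g. the points and lines of a nonsingular elliptic quadric in $\mathrm{PG}(5,2)$. $Q(5,2)\times\mathbb{L}_3$ is the geometry with point set $\{(x,i): x \text{ a point of } Q(5,2),\ i\in\{0,1,2\}\}$ whose lines are the sets $\{(x,i),(y,i),(z,i)\}$ with $\{x,y,z\}$ a line of $Q(5,2)$ and $i\in\{0,1,2\}$, and the sets $\{(x,0),(x,1),(x,2)\}$; it is the unique slim dense near hexagon on $81$ points. $Q(5,2)\otimes Q(5,2)$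 denotes the (up to isomorphism unique) slim dense near hexagon on $243$ points. A finite $2$-group $G$ is extra-special if its Frattini subgroup, commutator subgroup and center coincide and have order $2$; then $|G|=2^{1+2m}$, and $2^{1+2m}_+$ denotes the central product of $m$ copies of the dihedral group $D_8$, while $2^{1+2m}_-$ denotes the central product of $m-1$ copies of $D_8$ and one copy of the quaternion group $Q_8$. -}

module Defs where

open import Level using (0ℓ)
open import Data.Bool using (Bool; true; false; _xor_; _∧_; not; T)
open import Data.Nat using (ℕ; suc; pred)
open import Data.Fin using (Fin)
open import Data.Vec using (Vec; []; _∷_; zipWith; replicate; foldr)
open import Data.List using (List; []; _∷_)
open import Data.Product using (Σ; ∃; _×_; _,_; proj₁; proj₂)
open import Data.Sum using (_⊎_)
open import Relation.Binary.PropositionalEquality using (_≡_; _≢_)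
open import Algebra.Bundles.Raw using (RawGroup)

-- A slim partial linear space, given by its point set and the ternary
-- relation "x, y, z are the three points of a line" (symmetric in x,y,z).
record SlimPLS : Set₁ where
  field
    Point  : Set
    IsLine : Point → Point → Point → Set

-- Groups are given as raw groups whose equality is propositional equality.
module _ (G : RawGroup 0ℓ 0ℓ) where
  open RawGroup G

  IsInvolution : Carrier → Set
  IsInvolution g = (g ≢ ε) × (g ∙ g ≡ ε)

  IsNonAbelian : Set
  IsNonAbelian = Σ Carrier λ g → Σ Carrier λ h → g ∙ h ≢ h ∙ g

  evalWord : {P : Set} → (P → Carrier) → List (P × Bool) → Carrier
  evalWord ψ [] = ε
  evalWord ψ ((p , false) ∷ ws) = ψ p ∙ evalWord ψ ws
  evalWord ψ ((p , true) ∷ ws) = (ψ p ⁻¹) ∙ evalWord ψ ws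

  GeneratedBy : {P : Set} → (P → Carrier) → Set
  GeneratedBy {P} ψ = (g : Carrier) → Σ (List (P × Bool)) λ ws → g ≡ evalWord ψ ws

  record Representation (S : SlimPLS) : Set where
    open SlimPLS S
    field
      ψ          : Point → Carrier
      involution : (p : Point) → IsInvolution (ψ p)
      generates  : GeneratedBy ψ
      line-inj   : ∀ x y z → IsLine x y z → (ψ x ≢ ψ y) × (ψ y ≢ ψ z) × (ψ x ≢ ψ z)
      line-mul   : ∀ x y z → IsLine x y z → ψ x ∙ ψ y ≡ ψ z

  HasNonAbelianRepresentation : SlimPLS → Set
  HasNonAbelianRepresentation S = Representation S × IsNonAbelian

-- Elements: (v , c) with v ∈ (F₂²)^m (one F₂²-block per factor) and
-- c ∈ F₂ (the centre).  Multiplication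
--   (v , c) (w , d) = (v + w , c + d + β(v , w))
-- with β the sum of the block cocycles.  With the block cocycle βD the
-- group F₂² ×_β F₂ is the dihedral group D₈, with βQ it is the
-- quaternion group Q₈; summing cocycles over blocks (and identifying
-- the centres) is exactly the central product of the factors.

data Factor : Set where
  D₈ Q₈ : Factor

Block : Set
Block = Bool × Bool

βblock : Factor → Block → Block → Bool
βblock D₈ (a₁ , a₂) (b₁ , b₂) = a₁ ∧ b₂
βblock Q₈ (a₁ , a₂) (b₁ , b₂) = (a₁ ∧ b₁) xor ((a₁ ∧ b₂) xor (a₂ ∧ b₂))

addBlock : Block → Block → Block
addBlock (a₁ , a₂) (b₁ , b₂) = (a₁ xor b₁ , a₂ xor b₂)

β : ∀ {m} → Vec Factor m → Vec Block m → Vec Block m → Bool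
β [] [] [] = false
β (f ∷ fs) (a ∷ as) (b ∷ bs) = βblock f a b xor β fs as bs

CentralProduct : ∀ {m} → Vec Factor m → RawGroup 0ℓ 0ℓ
CentralProduct {m} fs = record
  { Carrier = Vec Block m × Bool
  ; _≈_     = _≡_
  ; _∙_     = λ { (v , c) (w , d) → (zipWith addBlock v w , (c xor d) xor β fs v w) }
  ; ε       = (replicate m (false , false) , false)
  ; _⁻¹     = λ { (v , c) → (v , c xor β fs v v) }
  }

ExtraSpecial⁺ : ℕ → RawGroup 0ℓ 0ℓ
ExtraSpecial⁺ m = CentralProduct (replicate m D₈)

-- 2^{1+2m}_- (m ≥ 1) : central product of m-1 copies of D₈ and one Q₈
ExtraSpecial⁻ : ℕ → RawGroup 0ℓ 0ℓ
ExtraSpecial⁻ m = CentralProduct (Q₈ ∷ replicate (pred m) D₈)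

data F₄ : Set where
  𝟘 𝟙 ω ω² : F₄

_+₄_ : F₄ → F₄ → F₄
𝟘 +₄ b = b
a +₄ 𝟘 = a
𝟙 +₄ 𝟙 = 𝟘
𝟙 +₄ ω = ω²
𝟙 +₄ ω² = ω
ω +₄ 𝟙 = ω²
ω +₄ ω = 𝟘
ω +₄ ω² = 𝟙
ω² +₄ 𝟙 = ω
ω² +₄ ω = 𝟙
ω² +₄ ω² = 𝟘

_*₄_ : F₄ → F₄ → F₄
𝟘 *₄ b = 𝟘
a *₄ 𝟘 = 𝟘
𝟙 *₄ b = b
a *₄ 𝟙 = a
ω *₄ ω = ω²
ω *₄ ω² = 𝟙
ω² *₄ ω = 𝟙
ω² *₄ ω² = ω

-- field norm F₄ → F₂ (x ↦ x³)
N₄ : F₄ → Bool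
N₄ 𝟘 = false
N₄ _ = true

isZero₄ : F₄ → Bool
isZero₄ 𝟘 = true
isZero₄ _ = false

-- V = F₄³, regarded as the 6-dimensional F₂-vector space F₂⁶
V : Set
V = Vec F₄ 3

_+ᵥ_ : V → V → V
_+ᵥ_ = zipWith _+₄_

_·ᵥ_ : F₄ → V → V
λ₀ ·ᵥ v = Data.Vec.map (λ a → λ₀ *₄ a) v

isZeroᵥ : V → Bool
isZeroᵥ v = foldr _ (λ a r → isZero₄ a ∧ r) true v

-- the nonsingular elliptic quadratic form Q(v) = N(v₁) + N(v₂) + N(v₃)
-- on F₂⁶ = F₄³ (it has 27 singular points, so it is of minus type)
Qform : V → Bool
Qform v = foldr _ (λ a r → N₄ a xor r) false v

isQPoint : V → Bool
isQPoint v = not (isZeroᵥ v) ∧ not (Qform v)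

-- three vectors forming a line of the quadric {x , y , x + y}
-- (for singular x, y, z this is symmetric in x, y, z)
QLineV : V → V → V → Set
QLineV x y z = (x ≢ y) × (x +ᵥ y ≡ z)

QPoint : Set
QPoint = Σ V λ v → T (isQPoint v)

Q52 : SlimPLS
Q52 = record
  { Point  = QPoint
  ; IsLine = λ x y z → QLineV (proj₁ x) (proj₁ y) (proj₁ z)
  }

Q52×L3 : SlimPLS
Q52×L3 = record
  { Point  = QPoint × Fin 3
  ; IsLine = λ { (x , i) (y , j) (z , k) →
        (QLineV (proj₁ x) (proj₁ y) (proj₁ z) × (i ≡ j) × (j ≡ k))
      ⊎ ((proj₁ x ≡ proj₁ y) × (proj₁ y ≡ proj₁ z) × (i ≢ j) × (j ≢ k) × (i ≢ k)) }
  }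

-- The scalars ω ∈ F₄* act on Q(5,2) fixing every line of the spread
-- {⟨v⟩_{F₄}} and acting regularly on each such line.  Q(5,2) ⊗ Q(5,2)
-- is the quotient of the product Q(5,2) × Q(5,2) (lines: {(a,x),(b,x),(c,x)}
-- and {(x,a),(x,b),(x,c)}) by the diagonal action (x , y) ↦ (λx , λy),
-- λ ∈ F₄*.  Each orbit is represented by the unique pair whose first
-- component has leading (first nonzero) coordinate 1.

lead : V → F₄
lead v = foldr _ (λ a r → if0 a r) 𝟘 v
  where
  if0 : F₄ → F₄ → F₄
  if0 𝟘 r = r
  if0 a r = a

isNormalised : V → Bool
isNormalised v with lead v
... | 𝟙 = true
... | _ = false

TPoint : Set
TPoint = Σ (QPoint × QPoint) λ p → T (isNormalised (proj₁ (proj₁ p)))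

-- three orbits form a line iff they have representatives forming a line
-- of the product geometry
TLine : TPoint → TPoint → TPoint → Set
TLine ((x₁ , x₂) , _) ((y₁ , y₂) , _) ((z₁ , z₂) , _) =
  Σ F₄ λ λx → Σ F₄ λ λy → Σ F₄ λ λz →
    (λx ≢ 𝟘) × (λy ≢ 𝟘) × (λz ≢ 𝟘) ×
    ( ( QLineV (λx ·ᵥ proj₁ x₁) (λy ·ᵥ proj₁ y₁) (λz ·ᵥ proj₁ z₁)
      × (λx ·ᵥ proj₁ x₂ ≡ λy ·ᵥ proj₁ y₂) × (λy ·ᵥ proj₁ y₂ ≡ λz ·ᵥ proj₁ z₂))
    ⊎ ( QLineV (λx ·ᵥ proj₁ x₂) (λy ·ᵥ proj₁ y₂) (λz ·ᵥ proj₁ z₂)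
      × (λx ·ᵥ proj₁ x₁ ≡ λy ·ᵥ proj₁ y₁) × (λy ·ᵥ proj₁ y₁ ≡ λz ·ᵥ proj₁ z₁)))

Q52⊗Q52 : SlimPLS
Q52⊗Q52 = record { Point = TPoint ; IsLine = TLine }

{-# OPTIONS --safe #-}
module Submission where

-- An embedding of a slim geometry over F₂ lifts to a central product, with
-- trivial central coordinates, as soon as the cocycle vanishes on each point
-- and along each line.
--
-- For Q(5,2) × L₃ take (x , i) ↦ x ⊗ eᵢ in F₂⁶ ⊗ F₂² with the cocycle B ⊗ g,
-- where B is the polar form of the quadric and g is the D₈-cocycle: B is
-- alternating and vanishes on collinear pairs.
--
-- For Q(5,2) ⊗ Q(5,2) take (x , y) ↦ x ⊗ ȳ in F₄⁹, which is invariant under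
-- the diagonal action because k k̄ = 1.  With the cocycle Tr (ω h) of nine
-- copies of Q₈, h the standard Hermitian form, h (x ⊗ ȳ , x′ ⊗ ȳ) is
-- h (x , x′) h (y , y) = 0, and symmetrically in the other factor.  Finally
-- Q₈ ∘ Q₈ ≅ D₈ ∘ D₈ turns eight of the nine copies of Q₈ into copies of D₈.

open import Algebra.Bundles.Raw using (RawGroup)
open import Algebra.Morphism.Structures using (module GroupMorphisms)
open import Data.Bool using (Bool; true; false; _xor_; _∧_; _∨_; not; T)
open import Data.Bool.Properties using (_≟_; T?; xor-assoc; xor-identityʳ; xor-same; ∧-assoc; ∧-idem; ∧-identityʳ; ∧-zeroʳ; ∧-distribˡ-xor; ∧-distribʳ-xor; ∨-zeroʳ; ∨-distribˡ-∧; ∨-distribʳ-∧)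
open import Data.Bool.Solver using (module xor-∧-Solver)
open import Data.Fin using (Fin)
open import Data.Fin.Patterns using (0F; 1F; 2F)
open import Data.List using (List; []; _∷_; _++_)
open import Data.Nat using (zero; suc; _*_)
open import Data.Product using (Σ; _×_; _,_; proj₁; proj₂)
open import Data.Product.Properties using (≡-dec)
open import Data.Sum using (inj₁; inj₂)
open import Data.Vec using (Vec; []; _∷_; zipWith; replicate; foldr; map; splitAt) renaming (_++_ to _++ᵥ_)
open import Data.Vec.Properties using (zipWith-assoc; zipWith-identityˡ; zipWith-identityʳ; zipWith-++)
open import Function using (_∘_)
open import Relation.Binary.PropositionalEquality
open import Relation.Nullary using (Dec; contradiction; _×-dec_; _→-dec_)
open import Relation.Nullary.Decidable using (True; toWitness; map′)
open import Defs

open xor-∧-Solver using (solve; con; _:=_; _:+_; _:*_)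

-- Arithmetic and cocycles of a single block

zeroBlock : Block
zeroBlock = false , false

addBlock-assoc : ∀ a b c → addBlock (addBlock a b) c ≡ addBlock a (addBlock b c)
addBlock-assoc (a₁ , a₂) (b₁ , b₂) (c₁ , c₂) = cong₂ _,_ (xor-assoc a₁ b₁ c₁) (xor-assoc a₂ b₂ c₂)

addBlock-identityʳ : ∀ a → addBlock a zeroBlock ≡ a
addBlock-identityʳ (a₁ , a₂) = cong₂ _,_ (xor-identityʳ a₁) (xor-identityʳ a₂)

addBlock-self : ∀ a → addBlock a a ≡ zeroBlock
addBlock-self (a₁ , a₂) = cong₂ _,_ (xor-same a₁) (xor-same a₂)

βblock-addˡ : ∀ f a b c → βblock f (addBlock a b) c ≡ βblock f a c xor βblock f b c
βblock-addˡ D₈ (a₁ , _) (b₁ , _) (_ , c₂) = ∧-distribʳ-xor c₂ a₁ b₁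
βblock-addˡ Q₈ (a₁ , a₂) (b₁ , b₂) (c₁ , c₂) =
  solve 6 (λ a₁ a₂ b₁ b₂ c₁ c₂ →
      (a₁ :+ b₁) :* c₁ :+ ((a₁ :+ b₁) :* c₂ :+ (a₂ :+ b₂) :* c₂)
      := (a₁ :* c₁ :+ (a₁ :* c₂ :+ a₂ :* c₂)) :+ (b₁ :* c₁ :+ (b₁ :* c₂ :+ b₂ :* c₂)))
    refl a₁ a₂ b₁ b₂ c₁ c₂

βblock-addʳ : ∀ f a b c → βblock f a (addBlock b c) ≡ βblock f a b xor βblock f a c
βblock-addʳ D₈ (a₁ , _) (_ , b₂) (_ , c₂) =
  solve 3 (λ a b c → a :* (b :+ c) := a :* b :+ a :* c) refl a₁ b₂ c₂
βblock-addʳ Q₈ (a₁ , a₂) (b₁ , b₂) (c₁ , c₂) =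
  solve 6 (λ a₁ a₂ b₁ b₂ c₁ c₂ →
      a₁ :* (b₁ :+ c₁) :+ (a₁ :* (b₂ :+ c₂) :+ a₂ :* (b₂ :+ c₂))
      := (a₁ :* b₁ :+ (a₁ :* b₂ :+ a₂ :* b₂)) :+ (a₁ :* c₁ :+ (a₁ :* c₂ :+ a₂ :* c₂)))
    refl a₁ a₂ b₁ b₂ c₁ c₂

βblock-zeroˡ : ∀ f b → βblock f zeroBlock b ≡ false
βblock-zeroˡ D₈ b = refl
βblock-zeroˡ Q₈ b = refl

βblock-zeroʳ : ∀ f a → βblock f a zeroBlock ≡ false
βblock-zeroʳ D₈ (a₁ , a₂) = ∧-zeroʳ a₁
βblock-zeroʳ Q₈ (a₁ , a₂) rewrite ∧-zeroʳ a₁ | ∧-zeroʳ a₂ = refl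

xor-interchange : ∀ a b c d → (a xor b) xor (c xor d) ≡ (a xor c) xor (b xor d)
xor-interchange = solve 4 (λ a b c d → (a :+ b) :+ (c :+ d) := (a :+ c) :+ (b :+ d)) refl

-- Block vectors and their cocycle

infixl 6 _⊕_

_⊕_ : ∀ {m} → Vec Block m → Vec Block m → Vec Block m
_⊕_ = zipWith addBlock

𝟎 : ∀ {m} → Vec Block m
𝟎 {m} = replicate m zeroBlock

⊕-assoc : ∀ {m} (u v w : Vec Block m) → (u ⊕ v) ⊕ w ≡ u ⊕ (v ⊕ w)
⊕-assoc = zipWith-assoc addBlock-assoc

⊕-identityˡ : ∀ {m} (v : Vec Block m) → 𝟎 ⊕ v ≡ v
⊕-identityˡ = zipWith-identityˡ (λ _ → refl)

⊕-identityʳ : ∀ {m} (v : Vec Block m) → v ⊕ 𝟎 ≡ v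
⊕-identityʳ = zipWith-identityʳ addBlock-identityʳ

⊕-self : ∀ {m} (v : Vec Block m) → v ⊕ v ≡ 𝟎
⊕-self []      = refl
⊕-self (a ∷ v) = cong₂ _∷_ (addBlock-self a) (⊕-self v)

β-addˡ : ∀ {m} (fs : Vec Factor m) u v w → β fs (u ⊕ v) w ≡ β fs u w xor β fs v w
β-addˡ []       []      []      []      = refl
β-addˡ (f ∷ fs) (a ∷ u) (b ∷ v) (c ∷ w) =
  trans (cong₂ _xor_ (βblock-addˡ f a b c) (β-addˡ fs u v w))
        (xor-interchange (βblock f a c) (βblock f b c) (β fs u w) (β fs v w))

β-addʳ : ∀ {m} (fs : Vec Factor m) u v w → β fs u (v ⊕ w) ≡ β fs u v xor β fs u w
β-addʳ []       []      []      []      = refl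
β-addʳ (f ∷ fs) (a ∷ u) (b ∷ v) (c ∷ w) =
  trans (cong₂ _xor_ (βblock-addʳ f a b c) (β-addʳ fs u v w))
        (xor-interchange (βblock f a b) (βblock f a c) (β fs u v) (β fs u w))

β-zeroˡ : ∀ {m} (fs : Vec Factor m) v → β fs 𝟎 v ≡ false
β-zeroˡ []       []      = refl
β-zeroˡ (f ∷ fs) (a ∷ v) = cong₂ _xor_ (βblock-zeroˡ f a) (β-zeroˡ fs v)

β-zeroʳ : ∀ {m} (fs : Vec Factor m) v → β fs v 𝟎 ≡ false
β-zeroʳ []       []      = refl
β-zeroʳ (f ∷ fs) (a ∷ v) = cong₂ _xor_ (βblock-zeroʳ f a) (β-zeroʳ fs v)

-- A Boolean zero test, so that a point being nonzero reduces to Boolean identities about its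
-- coordinates.
vanishes : ∀ {m} → Vec Block m → Bool
vanishes []              = true
vanishes ((a , b) ∷ v) = (not a ∧ not b) ∧ vanishes v

vanishes-𝟎 : ∀ m → vanishes (𝟎 {m}) ≡ true
vanishes-𝟎 zero  = refl
vanishes-𝟎 (suc m) = vanishes-𝟎 m

nonvanishing⇒≢𝟎 : ∀ {m} {v : Vec Block m} → vanishes v ≡ false → v ≢ 𝟎
nonvanishing⇒≢𝟎 {m} v≢0 refl with () ← trans (sym v≢0) (vanishes-𝟎 m)

-- Representations in central products

module _ {m} (fs : Vec Factor m) where
  open RawGroup (CentralProduct fs)

  -- Bilinearity makes `β` a 2-cocycle: both sides carry the three values of `β` on pairs from `u`,
  -- `v`, `w`.
  ∙-assoc : ∀ g h k → (g ∙ h) ∙ k ≡ g ∙ (h ∙ k)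
  ∙-assoc (u , c) (v , d) (w , e) = cong₂ _,_ (⊕-assoc u v w) (begin
    (((c xor d) xor β fs u v) xor e) xor β fs (u ⊕ v) w
      ≡⟨ cong ((((c xor d) xor β fs u v) xor e) xor_) (β-addˡ fs u v w) ⟩
    (((c xor d) xor β fs u v) xor e) xor (β fs u w xor β fs v w)
      ≡⟨ solve 6 (λ c d e x y z → (((c :+ d) :+ x) :+ e) :+ (y :+ z)
                               := (c :+ ((d :+ e) :+ z)) :+ (x :+ y))
           refl c d e (β fs u v) (β fs u w) (β fs v w) ⟩
    (c xor ((d xor e) xor β fs v w)) xor (β fs u v xor β fs u w)
      ≡⟨ cong ((c xor ((d xor e) xor β fs v w)) xor_) (β-addʳ fs u v w) ⟨
    (c xor ((d xor e) xor β fs v w)) xor β fs u (v ⊕ w) ∎)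
    where open ≡-Reasoning

  ∙-identityˡ : ∀ g → ε ∙ g ≡ g
  ∙-identityˡ (v , c) = cong₂ _,_ (⊕-identityˡ v)
    (trans (cong (c xor_) (β-zeroˡ fs v)) (xor-identityʳ c))

  module _ {P : Set} (ψ : P → Carrier) where

    Generated : Carrier → Set
    Generated g = Σ (List (P × Bool)) λ ws → g ≡ evalWord (CentralProduct fs) ψ ws

    evalWord-++ : ∀ ws ws′ → evalWord (CentralProduct fs) ψ (ws ++ ws′)
                ≡ evalWord (CentralProduct fs) ψ ws ∙ evalWord (CentralProduct fs) ψ ws′
    evalWord-++ []                 ws′ = sym (∙-identityˡ _)
    evalWord-++ ((p , false) ∷ ws) ws′ =
      trans (cong (ψ p ∙_) (evalWord-++ ws ws′)) (sym (∙-assoc (ψ p) _ _))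
    evalWord-++ ((p , true) ∷ ws)  ws′ =
      trans (cong (ψ p ⁻¹ ∙_) (evalWord-++ ws ws′)) (sym (∙-assoc (ψ p ⁻¹) _ _))

    generated-∙ : ∀ {g h} → Generated g → Generated h → Generated (g ∙ h)
    generated-∙ (ws , refl) (ws′ , refl) = ws ++ ws′ , sym (evalWord-++ ws ws′)

    -- Multiplying by the central element `(𝟎 , true)` flips the central coordinate and fixes the
    -- vector, so one generated lift of `v` yields the other.
    generated-coset : Generated (𝟎 , true) → ∀ {v c} → Generated (v , c) → ∀ d → Generated (v , d)
    generated-coset z {v} {c} g d = multiply c d g (generated-∙ g z)
      where
      multiply : ∀ c d → Generated (v , c) → Generated ((v , c) ∙ (𝟎 , true)) → Generated (v , d)
      multiply false false g gz = g
      multiply true  true  g gz = g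
      multiply false true  g gz = subst Generated (cong₂ _,_ (⊕-identityʳ v) (cong (true xor_) (β-zeroʳ fs v))) gz
      multiply true  false g gz = subst Generated (cong₂ _,_ (⊕-identityʳ v) (β-zeroʳ fs v)) gz

  -- Spanning as an induction principle, to be applied to predicates such as "some lift of `v` is
  -- generated".
  Spans : {P : Set} → (P → Vec Block m) → Set₁
  Spans {P} φ = (H : Vec Block m → Set) → (∀ u v → H u → H v → H (u ⊕ v)) →
                (∀ p → H (φ p)) → ∀ v → H v

  module _ (S : SlimPLS) (φ : SlimPLS.Point S → Vec Block m)
           (φ≢𝟎 : ∀ p → φ p ≢ 𝟎)
           (β-self : ∀ p → β fs (φ p) (φ p) ≡ false)
           (φ-line : ∀ x y z → SlimPLS.IsLine S x y z → φ x ⊕ φ y ≡ φ z)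
           (β-line : ∀ x y z → SlimPLS.IsLine S x y z → β fs (φ x) (φ y) ≡ false)
           (spans : Spans φ)
           where

    lift : SlimPLS.Point S → Carrier
    lift p = φ p , false

    liftRepresentation : Generated lift (𝟎 , true) → Representation (CentralProduct fs) S
    liftRepresentation z = record
      { ψ          = lift
      ; involution = λ p → φ≢𝟎 p ∘ cong proj₁ , cong₂ _,_ (⊕-self (φ p)) (β-self p)
      ; generates  = λ { (v , c) → generated-coset lift z (proj₂ (generated v)) c }
      -- In characteristic two each point of a line is the sum of the other two; if those coincide,
      -- it is `𝟎`.
      ; line-inj   = λ x y z l →
            (λ x≡y → φ≢𝟎 z (begin
              φ z        ≡⟨ φ-line x y z l ⟨
              φ x ⊕ φ y  ≡⟨ cong (_⊕ φ y) (cong proj₁ x≡y) ⟩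
              φ y ⊕ φ y  ≡⟨ ⊕-self (φ y) ⟩
              𝟎          ∎))
          , (λ y≡z → φ≢𝟎 x (begin
              φ x                ≡⟨ ⊕-identityʳ (φ x) ⟨
              φ x ⊕ 𝟎            ≡⟨ cong (φ x ⊕_) (⊕-self (φ y)) ⟨
              φ x ⊕ (φ y ⊕ φ y)  ≡⟨ ⊕-assoc (φ x) (φ y) (φ y) ⟨
              (φ x ⊕ φ y) ⊕ φ y  ≡⟨ cong (_⊕ φ y) (φ-line x y z l) ⟩
              φ z ⊕ φ y          ≡⟨ cong (φ z ⊕_) (cong proj₁ y≡z) ⟩
              φ z ⊕ φ z          ≡⟨ ⊕-self (φ z) ⟩
              𝟎                  ∎))
          , (λ x≡z → φ≢𝟎 y (begin
              φ y                ≡⟨ ⊕-identityˡ (φ y) ⟨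
              𝟎 ⊕ φ y            ≡⟨ cong (_⊕ φ y) (⊕-self (φ x)) ⟨
              (φ x ⊕ φ x) ⊕ φ y  ≡⟨ ⊕-assoc (φ x) (φ x) (φ y) ⟩
              φ x ⊕ (φ x ⊕ φ y)  ≡⟨ cong (φ x ⊕_) (φ-line x y z l) ⟩
              φ x ⊕ φ z          ≡⟨ cong (_⊕ φ z) (cong proj₁ x≡z) ⟩
              φ z ⊕ φ z          ≡⟨ ⊕-self (φ z) ⟩
              𝟎                  ∎))
      ; line-mul   = λ x y z l → cong₂ _,_ (φ-line x y z l) (β-line x y z l)
      }
      where
      open ≡-Reasoning
      generated : ∀ v → Σ Bool λ c → Generated lift (v , c)
      generated = spans (λ v → Σ Bool λ c → Generated lift (v , c))
        (λ { u v (c , g) (d , h) → _ , generated-∙ lift g h })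
        -- Words end in `ε`, so the one-letter word evaluates to `lift p ∙ ε`.
        (λ p → false , (p , false) ∷ [] , cong₂ _,_ (sym (⊕-identityʳ (φ p))) (sym (β-zeroʳ fs (φ p))))

-- Isomorphisms of central products

module _ {m n} (fs : Vec Factor m) (gs : Vec Factor n) where
  private
    G = CentralProduct fs
    H = CentralProduct gs
    module G = RawGroup G
    module H = RawGroup H
  open GroupMorphisms G H

  module _ {θ : G.Carrier → H.Carrier} (isIso : IsGroupIsomorphism θ) where
    open IsGroupIsomorphism isIso

    evalWord-homo : ∀ {P : Set} (ψ : P → G.Carrier) ws → θ (evalWord G ψ ws) ≡ evalWord H (θ ∘ ψ) ws
    evalWord-homo ψ []                 = ε-homo
    evalWord-homo ψ ((p , false) ∷ ws) =
      trans (∙-homo (ψ p) _) (cong (θ (ψ p) H.∙_) (evalWord-homo ψ ws))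
    evalWord-homo ψ ((p , true) ∷ ws)  =
      trans (∙-homo (ψ p G.⁻¹) _) (cong₂ H._∙_ (⁻¹-homo (ψ p)) (evalWord-homo ψ ws))

    transport : ∀ {S} → HasNonAbelianRepresentation G S → HasNonAbelianRepresentation H S
    transport (R , g , h , gh≢hg) = record
      { ψ          = θ ∘ ψ
      ; involution = λ p → (λ e → proj₁ (involution p) (injective (trans e (sym ε-homo))))
                         , trans (sym (∙-homo _ _)) (trans (cong θ (proj₂ (involution p))) ε-homo)
      ; generates  = λ k → let g , eq = surjective k ; ws , eq′ = generates g in
                         ws , trans (sym (eq refl)) (trans (cong θ eq′) (evalWord-homo ψ ws))
      ; line-inj   = λ x y z l → let x≢y , y≢z , x≢z = line-inj x y z l in
                         x≢y ∘ injective , y≢z ∘ injective , x≢z ∘ injective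
      ; line-mul   = λ x y z l → trans (sym (∙-homo _ _)) (cong θ (line-mul x y z l))
      } , θ g , θ h , λ e → gh≢hg (injective (trans (∙-homo g h) (trans e (sym (∙-homo h g)))))
      where open Representation R

-- Cohomologous cocycles define isomorphic central extensions: along the linear bijection `to` the
-- cocycles differ by the coboundary of `κ`, and `θ` absorbs it by shifting the central coordinate
-- by `κ`.
record CocycleEquivalence {m} (fs gs : Vec Factor m) : Set where
  field
    to from  : Vec Block m → Vec Block m
    from∘to  : ∀ v → from (to v) ≡ v
    to∘from  : ∀ v → to (from v) ≡ v
    to-⊕     : ∀ u v → to (u ⊕ v) ≡ to u ⊕ to v
    κ        : Vec Block m → Bool
    κ-𝟎      : κ 𝟎 ≡ false
    β-to     : ∀ u v → β gs (to u) (to v) ≡ β fs u v xor (κ u xor (κ v xor κ (u ⊕ v)))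

  to-𝟎 : to 𝟎 ≡ 𝟎
  to-𝟎 = trans (cong to (sym (⊕-self 𝟎))) (trans (to-⊕ 𝟎 𝟎) (⊕-self (to 𝟎)))

  private
    G = CentralProduct fs
    H = CentralProduct gs
    module G = RawGroup G
    module H = RawGroup H
  open GroupMorphisms G H

  θ : G.Carrier → H.Carrier
  θ (v , c) = to v , c xor κ v

  θ-∙ : ∀ g h → θ (g G.∙ h) ≡ θ g H.∙ θ h
  θ-∙ (u , c) (v , d) = cong₂ _,_ (to-⊕ u v) (begin
    ((c xor d) xor β fs u v) xor κ (u ⊕ v)
      ≡⟨ solve 6 (λ c d b x y z → ((c :+ d) :+ b) :+ z
                   := ((c :+ x) :+ (d :+ y)) :+ (b :+ (x :+ (y :+ z))))
           refl c d (β fs u v) (κ u) (κ v) (κ (u ⊕ v)) ⟩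
    ((c xor κ u) xor (d xor κ v)) xor (β fs u v xor (κ u xor (κ v xor κ (u ⊕ v))))
      ≡⟨ cong (((c xor κ u) xor (d xor κ v)) xor_) (β-to u v) ⟨
    ((c xor κ u) xor (d xor κ v)) xor β gs (to u) (to v) ∎)
    where open ≡-Reasoning

  -- The coboundary at `(v , v)` is `κ v + κ v + κ 𝟎`, which is zero: squares of elements are
  -- preserved.
  β-to-diagonal : ∀ v → β gs (to v) (to v) ≡ β fs v v
  β-to-diagonal v rewrite β-to v v | ⊕-self v | κ-𝟎 =
    solve 2 (λ b k → b :+ (k :+ (k :+ con false)) := b) refl (β fs v v) (κ v)

  θ-⁻¹ : ∀ g → θ (g G.⁻¹) ≡ θ g H.⁻¹
  θ-⁻¹ (v , c) = cong (to v ,_) (trans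
    (solve 3 (λ c b k → (c :+ b) :+ k := (c :+ k) :+ b) refl c (β fs v v) (κ v))
    (cong ((c xor κ v) xor_) (sym (β-to-diagonal v))))

  θ-injective : ∀ {g h} → θ g ≡ θ h → g ≡ h
  θ-injective {u , c} {v , d} eq with trans (sym (from∘to u)) (trans (cong from (cong proj₁ eq)) (from∘to v))
  ... | refl = cong (u ,_) (begin
    c                    ≡⟨ solve 2 (λ c k → c := (c :+ k) :+ k) refl c (κ u) ⟩
    (c xor κ u) xor κ u  ≡⟨ cong (_xor κ u) (cong proj₂ eq) ⟩
    (d xor κ u) xor κ u  ≡⟨ solve 2 (λ c k → c := (c :+ k) :+ k) refl d (κ u) ⟨
    d                    ∎)
    where open ≡-Reasoning

  θ-isGroupIsomorphism : IsGroupIsomorphism θ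
  θ-isGroupIsomorphism = record
    { isGroupMonomorphism = record
      { isGroupHomomorphism = record
        { isMonoidHomomorphism = record
          { isMagmaHomomorphism = record
            { isRelHomomorphism = record { cong = cong θ }
            ; homo              = θ-∙
            }
          ; ε-homo = cong₂ _,_ to-𝟎 κ-𝟎
          }
        ; ⁻¹-homo = θ-⁻¹
        }
      ; injective = θ-injective
      }
    ; surjective = λ { (v , c) → (from v , c xor κ (from v)) , λ { refl → cong₂ _,_ (to∘from v)
        (solve 2 (λ c k → (c :+ k) :+ k := c) refl c (κ (from v))) } }
    }

open CocycleEquivalence

[]-equivalence : CocycleEquivalence [] []
[]-equivalence = record
  { to = λ v → v ; from = λ v → v ; from∘to = λ _ → refl ; to∘from = λ _ → refl ; to-⊕ = λ _ _ → refl
  ; κ = λ _ → false ; κ-𝟎 = refl ; β-to = λ { [] [] → refl } }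

∷-equivalence : ∀ {m} f {fs gs : Vec Factor m} → CocycleEquivalence fs gs → CocycleEquivalence (f ∷ fs) (f ∷ gs)
∷-equivalence f {fs} E = record
  { to      = λ { (a ∷ v) → a ∷ E.to v }
  ; from    = λ { (a ∷ v) → a ∷ E.from v }
  ; from∘to = λ { (a ∷ v) → cong (a ∷_) (E.from∘to v) }
  ; to∘from = λ { (a ∷ v) → cong (a ∷_) (E.to∘from v) }
  ; to-⊕    = λ { (a ∷ u) (b ∷ v) → cong (addBlock a b ∷_) (E.to-⊕ u v) }
  ; κ       = λ { (a ∷ v) → E.κ v }
  ; κ-𝟎     = E.κ-𝟎
  ; β-to    = λ { (a ∷ u) (b ∷ v) → trans (cong (βblock f a b xor_) (E.β-to u v))
                (sym (xor-assoc (βblock f a b) (β fs u v) _)) }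
  }
  where module E = CocycleEquivalence E

-- Q₈ ∘ Q₈ ≅ D₈ ∘ D₈: with s = a + b the squaring form of Q₈ ∘ Q₈ factors as
-- N(a) + N(b) = s₁ (s₁ + b₂) + s₂ (s₂ + a₁).
hyperbolic hyperbolic⁻¹ : Block → Block → Block × Block
hyperbolic (a₁ , a₂) (b₁ , b₂) =
  (a₁ xor b₁ , (a₁ xor b₁) xor b₂) , (a₂ xor b₂ , (a₂ xor b₂) xor a₁)
hyperbolic⁻¹ (p₁ , p₂) (r₁ , r₂) =
  (r₁ xor r₂ , r₁ xor (p₁ xor p₂)) , (p₁ xor (r₁ xor r₂) , p₁ xor p₂)

-- The two cocycles have the same diagonal, so they differ by an alternating form; this is a
-- quadratic form whose polarisation is that difference.
κ-block : Block → Block → Bool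
κ-block (a₁ , a₂) (b₁ , b₂) = (a₁ ∧ a₂) xor βblock Q₈ (a₁ , a₂) (b₁ , b₂)

Q₈Q₈-equivalence : ∀ {m} {fs gs : Vec Factor m} → CocycleEquivalence fs gs →
                   CocycleEquivalence (Q₈ ∷ Q₈ ∷ fs) (D₈ ∷ D₈ ∷ gs)
Q₈Q₈-equivalence {fs = fs} {gs} E = record
  { to      = λ { (a ∷ b ∷ v) → proj₁ (hyperbolic a b) ∷ proj₂ (hyperbolic a b) ∷ E.to v }
  ; from    = λ { (p ∷ r ∷ v) → proj₁ (hyperbolic⁻¹ p r) ∷ proj₂ (hyperbolic⁻¹ p r) ∷ E.from v }
  ; from∘to = λ { ((a₁ , a₂) ∷ (b₁ , b₂) ∷ v) → cong₂ _∷_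
      (cong₂ _,_ (xor-cancelˡ (a₂ xor b₂) a₁) (solve 4 (λ a₁ a₂ b₁ b₂ → (a₂ :+ b₂) :+ ((a₁ :+ b₁) :+ ((a₁ :+ b₁) :+ b₂)) := a₂) refl a₁ a₂ b₁ b₂))
      (cong₂ _∷_
        (cong₂ _,_ (solve 4 (λ a₁ a₂ b₁ b₂ → (a₁ :+ b₁) :+ ((a₂ :+ b₂) :+ ((a₂ :+ b₂) :+ a₁)) := b₁) refl a₁ a₂ b₁ b₂) (xor-cancelˡ (a₁ xor b₁) b₂))
        (E.from∘to v)) }
  ; to∘from = λ { ((p₁ , p₂) ∷ (r₁ , r₂) ∷ v) → cong₂ _∷_
      (cong₂ _,_ (xor-cancel-middle r₁ r₂ p₁) (trans (cong (_xor (p₁ xor p₂)) (xor-cancel-middle r₁ r₂ p₁)) (xor-cancelˡ p₁ p₂)))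
      (cong₂ _∷_
        (cong₂ _,_ (xor-cancelʳ p₁ p₂ r₁) (trans (cong (_xor (r₁ xor r₂)) (xor-cancelʳ p₁ p₂ r₁)) (xor-cancelˡ r₁ r₂)))
        (E.to∘from v)) }
  ; to-⊕    = λ { ((a₁ , a₂) ∷ (b₁ , b₂) ∷ u) ((c₁ , c₂) ∷ (d₁ , d₂) ∷ v) → cong₂ _∷_
      (cong₂ _,_ (xor-interchange a₁ c₁ b₁ d₁) (interchange₃ a₁ c₁ b₁ d₁ b₂ d₂))
      (cong₂ _∷_
        (cong₂ _,_ (xor-interchange a₂ c₂ b₂ d₂) (interchange₃ a₂ c₂ b₂ d₂ a₁ c₁))
        (E.to-⊕ u v)) }
  ; κ       = λ { (a ∷ b ∷ v) → κ-block a b xor E.κ v }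
  ; κ-𝟎     = E.κ-𝟎
  ; β-to    = λ { (a ∷ b ∷ u) (c ∷ d ∷ v) → β-to-∷∷ a b c d u v }
  }
  where
  module E = CocycleEquivalence E

  xor-cancelˡ : ∀ x y → x xor (x xor y) ≡ y
  xor-cancelˡ = solve 2 (λ x y → x :+ (x :+ y) := y) refl

  xor-cancel-middle : ∀ r₁ r₂ p → (r₁ xor r₂) xor (p xor (r₁ xor r₂)) ≡ p
  xor-cancel-middle = solve 3 (λ r₁ r₂ p → (r₁ :+ r₂) :+ (p :+ (r₁ :+ r₂)) := p) refl

  xor-cancelʳ : ∀ p₁ p₂ r → (r xor (p₁ xor p₂)) xor (p₁ xor p₂) ≡ r
  xor-cancelʳ = solve 3 (λ p₁ p₂ r → (r :+ (p₁ :+ p₂)) :+ (p₁ :+ p₂) := r) refl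

  interchange₃ : ∀ a b c d e f → ((a xor b) xor (c xor d)) xor (e xor f) ≡ ((a xor c) xor e) xor ((b xor d) xor f)
  interchange₃ = solve 6 (λ a b c d e f →
    ((a :+ b) :+ (c :+ d)) :+ (e :+ f) := ((a :+ c) :+ e) :+ ((b :+ d) :+ f)) refl

  β-to-∷∷ : ∀ a b c d u v →
    βblock D₈ (proj₁ (hyperbolic a b)) (proj₁ (hyperbolic c d)) xor
      (βblock D₈ (proj₂ (hyperbolic a b)) (proj₂ (hyperbolic c d)) xor β gs (E.to u) (E.to v))
    ≡ (βblock Q₈ a c xor (βblock Q₈ b d xor β fs u v)) xor
      ((κ-block a b xor E.κ u) xor ((κ-block c d xor E.κ v) xor
        (κ-block (addBlock a c) (addBlock b d) xor E.κ (u ⊕ v))))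
  β-to-∷∷ (a₁ , a₂) (b₁ , b₂) (c₁ , c₂) (d₁ , d₂) u v rewrite E.β-to u v =
    -- A polynomial identity over F₂: `q` is the Q₈-cocycle, `k` is `κ-block`, and `t`, `x`, `y`,
    -- `z` stand for the contributions of the tails.
    solve 12 (λ a₁ a₂ b₁ b₂ c₁ c₂ d₁ d₂ t x y z →
      let q a₁ a₂ b₁ b₂ = a₁ :* b₁ :+ (a₁ :* b₂ :+ a₂ :* b₂)
          k a₁ a₂ b₁ b₂ = a₁ :* a₂ :+ q a₁ a₂ b₁ b₂ in
      (a₁ :+ b₁) :* ((c₁ :+ d₁) :+ d₂) :+ ((a₂ :+ b₂) :* ((c₂ :+ d₂) :+ c₁) :+ (t :+ (x :+ (y :+ z))))
      := (q a₁ a₂ c₁ c₂ :+ (q b₁ b₂ d₁ d₂ :+ t)) :+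
         ((k a₁ a₂ b₁ b₂ :+ x) :+ ((k c₁ c₂ d₁ d₂ :+ y) :+
           (k (a₁ :+ c₁) (a₂ :+ c₂) (b₁ :+ d₁) (b₂ :+ d₂) :+ z))))
      refl a₁ a₂ b₁ b₂ c₁ c₂ d₁ d₂ (β fs u v) (E.κ u) (E.κ v) (E.κ (u ⊕ v))

Q₈⁹≅2¹⁺¹⁸₋ : CocycleEquivalence (replicate 9 Q₈) (Q₈ ∷ replicate 8 D₈)
Q₈⁹≅2¹⁺¹⁸₋ = ∷-equivalence Q₈
  (Q₈Q₈-equivalence (Q₈Q₈-equivalence (Q₈Q₈-equivalence (Q₈Q₈-equivalence []-equivalence))))

-- F₄ and Q(5,2)

-- The F₂-basis (1 , ω²) of F₄ makes βblock Q₈ the form Tr (ω a b̄).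
toBlock : F₄ → Block
toBlock 𝟘  = false , false
toBlock 𝟙  = true , false
toBlock ω² = false , true
toBlock ω  = true , true

fromBlock : Block → F₄
fromBlock (false , false) = 𝟘
fromBlock (true , false)  = 𝟙
fromBlock (false , true)  = ω²
fromBlock (true , true)   = ω

toBlock∘fromBlock : ∀ b → toBlock (fromBlock b) ≡ b
toBlock∘fromBlock (false , false) = refl
toBlock∘fromBlock (true , false)  = refl
toBlock∘fromBlock (false , true)  = refl
toBlock∘fromBlock (true , true)   = refl

-- Finite identities over F₄ are proved by evaluating a decision procedure; the implicit argument is
-- then trivial.
decide : {A : Set} (A? : Dec A) → {True A?} → A
decide A? {yes} = toWitness yes

∀₄? : {P : F₄ → Set} → (∀ a → Dec (P a)) → Dec (∀ a → P a)
∀₄? P? = map′ (λ { (p₀ , p₁ , p₂ , p₃) → λ { 𝟘 → p₀ ; 𝟙 → p₁ ; ω → p₂ ; ω² → p₃ } })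
              (λ p → p 𝟘 , p 𝟙 , p ω , p ω²)
              (P? 𝟘 ×-dec P? 𝟙 ×-dec P? ω ×-dec P? ω²)

_≟ᵇ_ : (a b : Block) → Dec (a ≡ b)
_≟ᵇ_ = ≡-dec _≟_ _≟_

toBlock-+ : ∀ a b → toBlock (a +₄ b) ≡ addBlock (toBlock a) (toBlock b)
toBlock-+ = decide (∀₄? λ a → ∀₄? λ b → _ ≟ᵇ _)

+₄-identityʳ : ∀ a → a +₄ 𝟘 ≡ a
+₄-identityʳ 𝟘  = refl
+₄-identityʳ 𝟙  = refl
+₄-identityʳ ω  = refl
+₄-identityʳ ω² = refl

+₄-self : ∀ a → a +₄ a ≡ 𝟘
+₄-self 𝟘  = refl
+₄-self 𝟙  = refl
+₄-self ω  = refl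
+₄-self ω² = refl

zeros : ∀ {n} → Vec F₄ n
zeros {n} = replicate n 𝟘

+-identityˡ : ∀ {n} (v : Vec F₄ n) → zipWith _+₄_ zeros v ≡ v
+-identityˡ = zipWith-identityˡ (λ _ → refl)

+-identityʳ : ∀ {n} (v : Vec F₄ n) → zipWith _+₄_ v zeros ≡ v
+-identityʳ = zipWith-identityʳ +₄-identityʳ

+-self : ∀ {n} (v : Vec F₄ n) → zipWith _+₄_ v v ≡ zeros
+-self []      = refl
+-self (a ∷ v) = cong₂ _∷_ (+₄-self a) (+-self v)

-- `norm` and `isZero` extend `Qform` and `isZeroᵥ` to every length, for induction; at length three
-- they agree by definition.
norm : ∀ {n} → Vec F₄ n → Bool
norm = foldr _ (λ a r → N₄ a xor r) false

isZero : ∀ {n} → Vec F₄ n → Bool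
isZero = foldr _ (λ a r → isZero₄ a ∧ r) true

singular : ∀ v → T (isQPoint v) → Qform v ≡ false
singular v p with isZeroᵥ v | Qform v
... | false | false = refl

nonzero : ∀ v → T (isQPoint v) → isZeroᵥ v ≡ false
nonzero v p with isZeroᵥ v | Qform v
... | false | false = refl

-- Singular vectors are those of weight 2, and every element of F₄ is a sum
-- of two nonzero ones.
singular-spans : (H : V → Set) → (∀ u v → H u → H v → H (u +ᵥ v)) →
                 (∀ v → T (isQPoint v) → H v) → ∀ v → H v
singular-spans H add pt (a ∷ b ∷ c ∷ []) =
  subst H (cong₂ _∷_ (+₄-identityʳ a) (cong (_∷ c ∷ []) (+₄-identityʳ b)))
    (add _ _ (first a) (add _ _ (second b) (third c)))
  where
  -- At concrete singular vectors both implicit proofs have unit type and are inferred.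
  sum : ∀ u v → {T (isQPoint u)} → {T (isQPoint v)} → H (u +ᵥ v)
  sum u v {p} {q} = add u v (pt u p) (pt v q)

  -- The two summands share a `𝟙` in another coordinate, where it cancels; their remaining entries
  -- add up to `a`.
  first : ∀ a → H (a ∷ 𝟘 ∷ 𝟘 ∷ [])
  first 𝟘  = sum (𝟙 ∷ 𝟙 ∷ 𝟘 ∷ []) (𝟙  ∷ 𝟙 ∷ 𝟘 ∷ [])
  first 𝟙  = sum (ω ∷ 𝟙 ∷ 𝟘 ∷ []) (ω² ∷ 𝟙 ∷ 𝟘 ∷ [])
  first ω  = sum (𝟙 ∷ 𝟙 ∷ 𝟘 ∷ []) (ω² ∷ 𝟙 ∷ 𝟘 ∷ [])
  first ω² = sum (𝟙 ∷ 𝟙 ∷ 𝟘 ∷ []) (ω  ∷ 𝟙 ∷ 𝟘 ∷ [])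

  second : ∀ a → H (𝟘 ∷ a ∷ 𝟘 ∷ [])
  second 𝟘  = sum (𝟙 ∷ 𝟙 ∷ 𝟘 ∷ []) (𝟙 ∷ 𝟙  ∷ 𝟘 ∷ [])
  second 𝟙  = sum (𝟙 ∷ ω ∷ 𝟘 ∷ []) (𝟙 ∷ ω² ∷ 𝟘 ∷ [])
  second ω  = sum (𝟙 ∷ 𝟙 ∷ 𝟘 ∷ []) (𝟙 ∷ ω² ∷ 𝟘 ∷ [])
  second ω² = sum (𝟙 ∷ 𝟙 ∷ 𝟘 ∷ []) (𝟙 ∷ ω  ∷ 𝟘 ∷ [])

  third : ∀ a → H (𝟘 ∷ 𝟘 ∷ a ∷ [])
  third 𝟘  = sum (𝟙 ∷ 𝟘 ∷ 𝟙 ∷ []) (𝟙 ∷ 𝟘 ∷ 𝟙  ∷ [])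
  third 𝟙  = sum (𝟙 ∷ 𝟘 ∷ ω ∷ []) (𝟙 ∷ 𝟘 ∷ ω² ∷ [])
  third ω  = sum (𝟙 ∷ 𝟘 ∷ 𝟙 ∷ []) (𝟙 ∷ 𝟘 ∷ ω² ∷ [])
  third ω² = sum (𝟙 ∷ 𝟘 ∷ 𝟙 ∷ []) (𝟙 ∷ 𝟘 ∷ ω  ∷ [])

-- The representation of Q(5,2) × L₃

-- The polar form Tr (a b̄) of the norm of F₄, in coordinates.
polarBlock : Block → Block → Bool
polarBlock (a₁ , a₂) (b₁ , b₂) = (a₁ ∧ b₂) xor (a₂ ∧ b₁)

polar : ∀ {n} → Vec F₄ n → Vec F₄ n → Bool
polar []      []      = false
polar (a ∷ u) (b ∷ v) = polarBlock (toBlock a) (toBlock b) xor polar u v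

-- Tr (ω a ā) = N(a) Tr (ω), and ω has trace one.
N₄-quadratic : ∀ a → N₄ a ≡ βblock Q₈ (toBlock a) (toBlock a)
N₄-quadratic 𝟘  = refl
N₄-quadratic 𝟙  = refl
N₄-quadratic ω  = refl
N₄-quadratic ω² = refl

N₄-+ : ∀ a b → N₄ (a +₄ b) ≡ (N₄ a xor N₄ b) xor polarBlock (toBlock a) (toBlock b)
N₄-+ a b rewrite N₄-quadratic (a +₄ b) | toBlock-+ a b | N₄-quadratic a | N₄-quadratic b
  with toBlock a | toBlock b
... | a₁ , a₂ | b₁ , b₂ =
  solve 4 (λ a₁ a₂ b₁ b₂ →
      let q a₁ a₂ = a₁ :* a₁ :+ (a₁ :* a₂ :+ a₂ :* a₂) in
      q (a₁ :+ b₁) (a₂ :+ b₂) := (q a₁ a₂ :+ q b₁ b₂) :+ (a₁ :* b₂ :+ a₂ :* b₁))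
    refl a₁ a₂ b₁ b₂

norm-+ : ∀ {n} (u v : Vec F₄ n) → norm (zipWith _+₄_ u v) ≡ (norm u xor norm v) xor polar u v
norm-+ []      []      = refl
norm-+ (a ∷ u) (b ∷ v) = trans (cong₂ _xor_ (N₄-+ a b) (norm-+ u v))
  (solve 6 (λ a b c d e f → ((a :+ b) :+ c) :+ ((d :+ e) :+ f) := ((a :+ d) :+ (b :+ e)) :+ (c :+ f))
    refl (N₄ a) (N₄ b) (polarBlock (toBlock a) (toBlock b)) (norm u) (norm v) (polar u v))

polar-self : ∀ {n} (v : Vec F₄ n) → polar v v ≡ false
polar-self []      = refl
polar-self (a ∷ v) with toBlock a
... | a₁ , a₂ = cong₂ _xor_ (solve 2 (λ a b → a :* b :+ b :* a := con false) refl a₁ a₂) (polar-self v)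

-- All three points are singular, so polarising the quadratic form leaves only the polar term.
polar-line : ∀ (x y z : QPoint) → proj₁ x +ᵥ proj₁ y ≡ proj₁ z → polar (proj₁ x) (proj₁ y) ≡ false
polar-line (x , p) (y , q) (z , r) refl = begin
  polar x y                            ≡⟨ cong₂ (λ a b → (a xor b) xor polar x y) (singular x p) (singular y q) ⟨
  (Qform x xor Qform y) xor polar x y  ≡⟨ norm-+ x y ⟨
  Qform (x +ᵥ y)                       ≡⟨ singular z r ⟩
  false                                ∎
  where open ≡-Reasoning

polar-zeroˡ : ∀ {n} (v : Vec F₄ n) → polar zeros v ≡ false
polar-zeroˡ []      = refl
polar-zeroˡ (a ∷ v) = polar-zeroˡ v

polar-zeroʳ : ∀ {n} (v : Vec F₄ n) → polar v zeros ≡ false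
polar-zeroʳ []      = refl
polar-zeroʳ (a ∷ v) with toBlock a
... | a₁ , a₂ = cong₂ _xor_ (cong₂ _xor_ (∧-zeroʳ a₁) (∧-zeroʳ a₂)) (polar-zeroʳ v)

-- F₄ⁿ ⊕ F₄ⁿ, with blocks arranged so that the D₈-cocycle of (p , q) and
-- (p′ , q′) is polar p q′.
weave : ∀ {n} → Vec F₄ n → Vec F₄ n → Vec Block (n * 2)
weave []      []      = []
weave (a ∷ p) (b ∷ q) =
  (proj₁ (toBlock a) , proj₂ (toBlock b)) ∷ (proj₂ (toBlock a) , proj₁ (toBlock b)) ∷ weave p q

weave-+ : ∀ {n} (p q p′ q′ : Vec F₄ n) →
          weave p q ⊕ weave p′ q′ ≡ weave (zipWith _+₄_ p p′) (zipWith _+₄_ q q′)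
weave-+ []      []      []        []        = refl
weave-+ (a ∷ p) (b ∷ q) (a′ ∷ p′) (b′ ∷ q′) rewrite toBlock-+ a a′ | toBlock-+ b b′ =
  cong (λ w → _ ∷ _ ∷ w) (weave-+ p q p′ q′)

β-weave : ∀ {n} (p q p′ q′ : Vec F₄ n) →
          β (replicate (n * 2) D₈) (weave p q) (weave p′ q′) ≡ polar p q′
β-weave []      []      []        []        = refl
β-weave (a ∷ p) (b ∷ q) (a′ ∷ p′) (b′ ∷ q′) with toBlock a | toBlock b′
... | a₁ , a₂ | b₁ , b₂ rewrite β-weave p q p′ q′ = sym (xor-assoc (a₁ ∧ b₂) (a₂ ∧ b₁) (polar p q′))

weave-surjective : ∀ {n} (v : Vec Block (n * 2)) → Σ (Vec F₄ n × Vec F₄ n) λ (p , q) → weave p q ≡ v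
weave-surjective {zero} [] = ([] , []) , refl
weave-surjective {suc n} ((a₁ , b₂) ∷ (a₂ , b₁) ∷ v) with weave-surjective {n} v
... | (p , q) , eq = (fromBlock (a₁ , a₂) ∷ p , fromBlock (b₁ , b₂) ∷ q) , weave-∷
  where
  weave-∷ : weave (fromBlock (a₁ , a₂) ∷ p) (fromBlock (b₁ , b₂) ∷ q) ≡ (a₁ , b₂) ∷ (a₂ , b₁) ∷ v
  weave-∷ rewrite toBlock∘fromBlock (a₁ , a₂) | toBlock∘fromBlock (b₁ , b₂) | eq = refl

vanishes-weave : ∀ {n} (p q : Vec F₄ n) → vanishes (weave p q) ≡ isZero p ∧ isZero q
vanishes-weave []      []      = refl
vanishes-weave (a ∷ p) (b ∷ q) = begin
  (not a₁ ∧ not b₂) ∧ ((not a₂ ∧ not b₁) ∧ vanishes (weave p q))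
    ≡⟨ ∧-assoc (not a₁ ∧ not b₂) (not a₂ ∧ not b₁) _ ⟨
  ((not a₁ ∧ not b₂) ∧ (not a₂ ∧ not b₁)) ∧ vanishes (weave p q)
    ≡⟨ cong₂ _∧_ (both-zero a b) (vanishes-weave p q) ⟩
  (isZero₄ a ∧ isZero₄ b) ∧ (isZero p ∧ isZero q)
    ≡⟨ solve 4 (λ a b c d → (a :* b) :* (c :* d) := (a :* c) :* (b :* d))
         refl (isZero₄ a) (isZero₄ b) (isZero p) (isZero q) ⟩
  (isZero₄ a ∧ isZero p) ∧ (isZero₄ b ∧ isZero q) ∎
  where
  open ≡-Reasoning
  a₁ = proj₁ (toBlock a)
  a₂ = proj₂ (toBlock a)
  b₁ = proj₁ (toBlock b)
  b₂ = proj₂ (toBlock b)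
  both-zero : ∀ a b → (not (proj₁ (toBlock a)) ∧ not (proj₂ (toBlock b))) ∧
                      (not (proj₂ (toBlock a)) ∧ not (proj₁ (toBlock b)))
                    ≡ isZero₄ a ∧ isZero₄ b
  both-zero = decide (∀₄? λ a → ∀₄? λ b → _ ≟ _)

-- x ⊗ eᵢ in F₂⁶ ⊗ F₂², where e₀, e₁, e₂ = e₀ + e₁ are the nonzero vectors of F₂².
slice : V → Fin 3 → Vec Block 6
slice x 0F = weave x zeros
slice x 1F = weave zeros x
slice x 2F = weave x x

slice-+ : ∀ x y i → slice x i ⊕ slice y i ≡ slice (x +ᵥ y) i
slice-+ x y 0F = weave-+ x zeros y zeros
slice-+ x y 1F = weave-+ zeros x zeros y
slice-+ x y 2F = weave-+ x x y y

-- The three nonzero vectors of F₂² sum to zero. The last nine clauses contradict distinctness of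
-- the indices.
slice-third : ∀ x i j k → i ≢ j → j ≢ k → i ≢ k → slice x i ⊕ slice x j ≡ slice x k
slice-third x 0F 1F 2F _ _ _ = trans (weave-+ x zeros zeros x) (cong₂ weave (+-identityʳ x) (+-identityˡ x))
slice-third x 1F 0F 2F _ _ _ = trans (weave-+ zeros x x zeros) (cong₂ weave (+-identityˡ x) (+-identityʳ x))
slice-third x 0F 2F 1F _ _ _ = trans (weave-+ x zeros x x) (cong₂ weave (+-self x) (+-identityˡ x))
slice-third x 2F 0F 1F _ _ _ = trans (weave-+ x x x zeros) (cong₂ weave (+-self x) (+-identityʳ x))
slice-third x 1F 2F 0F _ _ _ = trans (weave-+ zeros x x x) (cong₂ weave (+-identityˡ x) (+-self x))
slice-third x 2F 1F 0F _ _ _ = trans (weave-+ x x zeros x) (cong₂ weave (+-identityʳ x) (+-self x))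
slice-third x 0F 0F _ i≢j _ _ = contradiction refl i≢j
slice-third x 1F 1F _ i≢j _ _ = contradiction refl i≢j
slice-third x 2F 2F _ i≢j _ _ = contradiction refl i≢j
slice-third x _ 0F 0F _ j≢k _ = contradiction refl j≢k
slice-third x _ 1F 1F _ j≢k _ = contradiction refl j≢k
slice-third x _ 2F 2F _ j≢k _ = contradiction refl j≢k
slice-third x 0F _ 0F _ _ i≢k = contradiction refl i≢k
slice-third x 1F _ 1F _ _ i≢k = contradiction refl i≢k
slice-third x 2F _ 2F _ _ i≢k = contradiction refl i≢k

-- The value is `polar x y` times g (eᵢ , eⱼ), so the same lemma serves points, lines inside a copy
-- of Q(5,2) and lines across the copies.
β-slice : ∀ x y i j → polar x y ≡ false → β (replicate 6 D₈) (slice x i) (slice y j) ≡ false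
β-slice x y 0F 0F e = trans (β-weave x zeros y zeros) (polar-zeroʳ x)
β-slice x y 0F 1F e = trans (β-weave x zeros zeros y) e
β-slice x y 0F 2F e = trans (β-weave x zeros y y) e
β-slice x y 1F 0F e = trans (β-weave zeros x y zeros) (polar-zeroˡ {3} zeros)
β-slice x y 1F 1F e = trans (β-weave zeros x zeros y) (polar-zeroˡ y)
β-slice x y 1F 2F e = trans (β-weave zeros x y y) (polar-zeroˡ y)
β-slice x y 2F 0F e = trans (β-weave x x y zeros) (polar-zeroʳ x)
β-slice x y 2F 1F e = trans (β-weave x x zeros y) e
β-slice x y 2F 2F e = trans (β-weave x x y y) e

vanishes-slice : ∀ x i → vanishes (slice x i) ≡ isZeroᵥ x
vanishes-slice x 0F = trans (vanishes-weave x zeros) (∧-identityʳ (isZeroᵥ x))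
vanishes-slice x 1F = vanishes-weave zeros x
vanishes-slice x 2F = trans (vanishes-weave x x) (∧-idem (isZeroᵥ x))

slice-spans : Spans (replicate 6 D₈) {QPoint × Fin 3} λ (x , i) → slice (proj₁ x) i
slice-spans H add pt v with weave-surjective {3} v
... | (p , q) , refl = subst H
  (trans (weave-+ p zeros zeros q) (cong₂ weave (+-identityʳ p) (+-identityˡ q)))
  (add _ _ (all 0F p) (all 1F q))
  where
  all : ∀ i x → H (slice x i)
  all i = singular-spans (λ x → H (slice x i))
    (λ x y hx hy → subst H (slice-+ x y i) (add _ _ hx hy)) (λ x p → pt ((x , p) , i))

Q52×L3-representation : HasNonAbelianRepresentation (ExtraSpecial⁺ 6) Q52×L3
Q52×L3-representation = liftRepresentation (replicate 6 D₈) Q52×L3 (λ (x , i) → slice (proj₁ x) i)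
  (λ { ((x , p) , i) → nonvanishing⇒≢𝟎 (trans (vanishes-slice x i) (nonzero x p)) })
  (λ { ((x , p) , i) → β-slice x x i i (polar-self x) })
  (λ { ((x , _) , i) ((y , _) , _) _ (inj₁ ((_ , refl) , refl , refl)) → slice-+ x y i
     ; ((x , _) , i) (_ , j) (_ , k) (inj₂ (refl , refl , i≢j , j≢k , i≢k)) →
         slice-third x i j k i≢j j≢k i≢k })
  (λ { (x , i) (y , _) (z , _) (inj₁ ((_ , x+y≡z) , refl , _)) →
         β-slice (proj₁ x) (proj₁ y) i i (polar-line x y z x+y≡z)
     ; ((x , _) , i) (_ , j) _ (inj₂ (refl , _)) → β-slice x x i j (polar-self x) })
  slice-spans
  -- For involutions `g`, `h` the word g h g h is their commutator. The polar form of the two chosen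
  -- vectors is one, so this is the central involution; the same pair witnesses noncommutativity.
  ((g , false) ∷ (h , false) ∷ (g , false) ∷ (h , false) ∷ [] , refl)
  , (slice (proj₁ (proj₁ g)) 0F , false) , (slice (proj₁ (proj₁ h)) 1F , false) , λ ()
  where
  g h : QPoint × Fin 3
  g = (𝟙 ∷ 𝟙 ∷ 𝟘 ∷ [] , _) , 0F
  h = (ω ∷ 𝟙 ∷ 𝟘 ∷ [] , _) , 1F

-- The representation of Q(5,2) ⊗ Q(5,2)

conj : F₄ → F₄
conj 𝟘  = 𝟘
conj 𝟙  = 𝟙
conj ω  = ω²
conj ω² = ω

entry : F₄ → F₄ → Block
entry a b = toBlock (a *₄ conj b)

entry-+ˡ : ∀ a a′ b → entry (a +₄ a′) b ≡ addBlock (entry a b) (entry a′ b)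
entry-+ˡ = decide (∀₄? λ a → ∀₄? λ a′ → ∀₄? λ b → _ ≟ᵇ _)

entry-+ʳ : ∀ a b b′ → entry a (b +₄ b′) ≡ addBlock (entry a b) (entry a b′)
entry-+ʳ = decide (∀₄? λ a → ∀₄? λ b → ∀₄? λ b′ → _ ≟ᵇ _)

entry-scale : ∀ k → k ≢ 𝟘 → ∀ a b → entry (k *₄ a) (k *₄ b) ≡ entry a b
entry-scale 𝟘  k≢0 = contradiction refl k≢0
entry-scale 𝟙  _   = decide (∀₄? λ a → ∀₄? λ b → _ ≟ᵇ _)
entry-scale ω  _   = decide (∀₄? λ a → ∀₄? λ b → _ ≟ᵇ _)
entry-scale ω² _   = decide (∀₄? λ a → ∀₄? λ b → _ ≟ᵇ _)

N₄-scale : ∀ k → k ≢ 𝟘 → ∀ a → N₄ (k *₄ a) ≡ N₄ a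
N₄-scale 𝟘  k≢0 = contradiction refl k≢0
N₄-scale 𝟙  _   = decide (∀₄? λ a → _ ≟ _)
N₄-scale ω  _   = decide (∀₄? λ a → _ ≟ _)
N₄-scale ω² _   = decide (∀₄? λ a → _ ≟ _)

entry-𝟙-surjective : ∀ b → Σ F₄ λ a → entry 𝟙 a ≡ b
entry-𝟙-surjective (false , false) = 𝟘 , refl
entry-𝟙-surjective (true , false)  = 𝟙 , refl
-- The preimages of `ω` and `ω²` are swapped, because `entry` conjugates its second argument.
entry-𝟙-surjective (false , true)  = ω , refl
entry-𝟙-surjective (true , true)   = ω² , refl

-- Tr (ω (a b̄) (a′ b̄)‾) = Tr (ω a a′‾) N(b), and likewise with the factors exchanged.
βQ₈-entry-sameʳ : ∀ a a′ b → βblock Q₈ (entry a b) (entry a′ b) ≡ βblock Q₈ (entry a 𝟙) (entry a′ 𝟙) ∧ N₄ b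
βQ₈-entry-sameʳ = decide (∀₄? λ a → ∀₄? λ a′ → ∀₄? λ b → _ ≟ _)

βQ₈-entry-sameˡ : ∀ a b b′ → βblock Q₈ (entry a b) (entry a b′) ≡ N₄ a ∧ βblock Q₈ (entry 𝟙 b) (entry 𝟙 b′)
βQ₈-entry-sameˡ = decide (∀₄? λ a → ∀₄? λ b → ∀₄? λ b′ → _ ≟ _)

-- F₄ has no zero divisors, and only zero has conjugate zero.
vanishes-entry : ∀ a b → not (proj₁ (entry a b)) ∧ not (proj₂ (entry a b)) ≡ isZero₄ a ∨ isZero₄ b
vanishes-entry = decide (∀₄? λ a → ∀₄? λ b → _ ≟ _)

-- Rows and tensors over F₄

βQ : ∀ {n} → Vec Block n → Vec Block n → Bool
βQ {n} = β (replicate n Q₈)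

row : ∀ {n} → F₄ → Vec F₄ n → Vec Block n
row a = map (entry a)

row-+ˡ : ∀ {n} a a′ (y : Vec F₄ n) → row (a +₄ a′) y ≡ row a y ⊕ row a′ y
row-+ˡ a a′ []      = refl
row-+ˡ a a′ (b ∷ y) = cong₂ _∷_ (entry-+ˡ a a′ b) (row-+ˡ a a′ y)

row-+ʳ : ∀ {n} a (y y′ : Vec F₄ n) → row a (zipWith _+₄_ y y′) ≡ row a y ⊕ row a y′
row-+ʳ a []      []        = refl
row-+ʳ a (b ∷ y) (b′ ∷ y′) = cong₂ _∷_ (entry-+ʳ a b b′) (row-+ʳ a y y′)

row-scale : ∀ k → k ≢ 𝟘 → ∀ {n} a (y : Vec F₄ n) → row (k *₄ a) (map (k *₄_) y) ≡ row a y
row-scale k k≢0 a []      = refl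
row-scale k k≢0 a (b ∷ y) = cong₂ _∷_ (entry-scale k k≢0 a b) (row-scale k k≢0 a y)

row-𝟘 : ∀ {n} (y : Vec F₄ n) → row 𝟘 y ≡ 𝟎
row-𝟘 []      = refl
row-𝟘 (b ∷ y) = cong (zeroBlock ∷_) (row-𝟘 y)

row-𝟙-surjective : ∀ {n} (v : Vec Block n) → Σ (Vec F₄ n) λ y → row 𝟙 y ≡ v
row-𝟙-surjective []      = [] , refl
row-𝟙-surjective (b ∷ v) with entry-𝟙-surjective b | row-𝟙-surjective v
... | a , refl | y , refl = a ∷ y , refl

vanishes-row : ∀ {n} a (y : Vec F₄ n) → vanishes (row a y) ≡ isZero₄ a ∨ isZero y
vanishes-row a []      = sym (∨-zeroʳ (isZero₄ a))
vanishes-row a (b ∷ y) = trans (cong₂ _∧_ (vanishes-entry a b) (vanishes-row a y))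
  (sym (∨-distribˡ-∧ (isZero₄ a) (isZero₄ b) (isZero y)))

βQ-row-sameʳ : ∀ {n} a a′ (y : Vec F₄ n) → βQ (row a y) (row a′ y) ≡ βblock Q₈ (entry a 𝟙) (entry a′ 𝟙) ∧ norm y
βQ-row-sameʳ a a′ []      = sym (∧-zeroʳ _)
βQ-row-sameʳ a a′ (b ∷ y) = trans (cong₂ _xor_ (βQ₈-entry-sameʳ a a′ b) (βQ-row-sameʳ a a′ y))
  (sym (∧-distribˡ-xor (βblock Q₈ (entry a 𝟙) (entry a′ 𝟙)) (N₄ b) (norm y)))

βQ-row-sameˡ : ∀ {n} a (y y′ : Vec F₄ n) → βQ (row a y) (row a y′) ≡ N₄ a ∧ βQ (row 𝟙 y) (row 𝟙 y′)
βQ-row-sameˡ a []      []        = sym (∧-zeroʳ (N₄ a))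
βQ-row-sameˡ a (b ∷ y) (b′ ∷ y′) = trans (cong₂ _xor_ (βQ₈-entry-sameˡ a b b′) (βQ-row-sameˡ a y y′))
  (sym (∧-distribˡ-xor (N₄ a) (βblock Q₈ (entry 𝟙 b) (entry 𝟙 b′)) (βQ (row 𝟙 y) (row 𝟙 y′))))

-- The rank-one matrix with entries xᵢ ȳⱼ, read row by row with one block per entry.
tensor : ∀ {m n} → Vec F₄ m → Vec F₄ n → Vec Block (m * n)
tensor []      y = []
tensor (a ∷ x) y = row a y ++ᵥ tensor x y

tensor-+ˡ : ∀ {m n} (x x′ : Vec F₄ m) (y : Vec F₄ n) → tensor (zipWith _+₄_ x x′) y ≡ tensor x y ⊕ tensor x′ y
tensor-+ˡ []      []        y = refl
tensor-+ˡ (a ∷ x) (a′ ∷ x′) y = trans (cong₂ _++ᵥ_ (row-+ˡ a a′ y) (tensor-+ˡ x x′ y))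
  (sym (zipWith-++ addBlock (row a y) (tensor x y) (row a′ y) (tensor x′ y)))

tensor-+ʳ : ∀ {m n} (x : Vec F₄ m) (y y′ : Vec F₄ n) → tensor x (zipWith _+₄_ y y′) ≡ tensor x y ⊕ tensor x y′
tensor-+ʳ []      y y′ = refl
tensor-+ʳ (a ∷ x) y y′ = trans (cong₂ _++ᵥ_ (row-+ʳ a y y′) (tensor-+ʳ x y y′))
  (sym (zipWith-++ addBlock (row a y) (tensor x y) (row a y′) (tensor x y′)))

tensor-scale : ∀ k → k ≢ 𝟘 → ∀ {m n} (x : Vec F₄ m) (y : Vec F₄ n) →
               tensor (map (k *₄_) x) (map (k *₄_) y) ≡ tensor x y
tensor-scale k k≢0 []      y = refl
tensor-scale k k≢0 (a ∷ x) y = cong₂ _++ᵥ_ (row-scale k k≢0 a y) (tensor-scale k k≢0 x y)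

norm-scale : ∀ k → k ≢ 𝟘 → ∀ {n} (x : Vec F₄ n) → norm (map (k *₄_) x) ≡ norm x
norm-scale k k≢0 []      = refl
norm-scale k k≢0 (a ∷ x) = cong₂ _xor_ (N₄-scale k k≢0 a) (norm-scale k k≢0 x)

vanishes-++ : ∀ {m n} (u : Vec Block m) (v : Vec Block n) → vanishes (u ++ᵥ v) ≡ vanishes u ∧ vanishes v
vanishes-++ []              v = refl
vanishes-++ ((a , b) ∷ u) v = trans (cong ((not a ∧ not b) ∧_) (vanishes-++ u v))
  (sym (∧-assoc (not a ∧ not b) (vanishes u) (vanishes v)))

vanishes-tensor : ∀ {m n} (x : Vec F₄ m) (y : Vec F₄ n) → vanishes (tensor x y) ≡ isZero x ∨ isZero y
vanishes-tensor []      y = refl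
vanishes-tensor (a ∷ x) y = begin
  vanishes (row a y ++ᵥ tensor x y)
    ≡⟨ vanishes-++ (row a y) (tensor x y) ⟩
  vanishes (row a y) ∧ vanishes (tensor x y)
    ≡⟨ cong₂ _∧_ (vanishes-row a y) (vanishes-tensor x y) ⟩
  (isZero₄ a ∨ isZero y) ∧ (isZero x ∨ isZero y)
    ≡⟨ ∨-distribʳ-∧ (isZero y) (isZero₄ a) (isZero x) ⟨
  (isZero₄ a ∧ isZero x) ∨ isZero y ∎
  where open ≡-Reasoning

βQ-++ : ∀ {m n} (u u′ : Vec Block m) (v v′ : Vec Block n) → βQ (u ++ᵥ v) (u′ ++ᵥ v′) ≡ βQ u u′ xor βQ v v′
βQ-++ []      []        v v′ = refl
βQ-++ (a ∷ u) (a′ ∷ u′) v v′ = trans (cong (βblock Q₈ a a′ xor_) (βQ-++ u u′ v v′))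
  (sym (xor-assoc (βblock Q₈ a a′) (βQ u u′) (βQ v v′)))

-- Each row already contributes a multiple of `norm y`, which is zero.
βQ-tensor-sameʳ : ∀ {m n} (x x′ : Vec F₄ m) (y : Vec F₄ n) → norm y ≡ false → βQ (tensor x y) (tensor x′ y) ≡ false
βQ-tensor-sameʳ []      []        y y⊥y = refl
βQ-tensor-sameʳ (a ∷ x) (a′ ∷ x′) y y⊥y =
  trans (βQ-++ (row a y) (row a′ y) (tensor x y) (tensor x′ y))
    (cong₂ _xor_ (trans (βQ-row-sameʳ a a′ y) (trans (cong (_ ∧_) y⊥y) (∧-zeroʳ _)))
                 (βQ-tensor-sameʳ x x′ y y⊥y))

-- Here the norm appears only after summing over rows: each contributes N(xᵢ) times one quantity
-- that depends on `y` and `y′` alone.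
βQ-tensor-sameˡ : ∀ {m n} (x : Vec F₄ m) (y y′ : Vec F₄ n) →
                  βQ (tensor x y) (tensor x y′) ≡ norm x ∧ βQ (row 𝟙 y) (row 𝟙 y′)
βQ-tensor-sameˡ []      y y′ = refl
βQ-tensor-sameˡ (a ∷ x) y y′ =
  trans (βQ-++ (row a y) (row a y′) (tensor x y) (tensor x y′))
    (trans (cong₂ _xor_ (βQ-row-sameˡ a y y′) (βQ-tensor-sameˡ x y y′))
           (sym (∧-distribʳ-xor (βQ (row 𝟙 y) (row 𝟙 y′)) (N₄ a) (norm x))))

tensor-zerosˡ : ∀ {m n} (y : Vec F₄ n) → tensor (zeros {m}) y ≡ 𝟎
tensor-zerosˡ {m} {n} y = begin
  tensor (zeros {m}) y                          ≡⟨ cong (λ z → tensor z y) (+-self (zeros {m})) ⟨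
  tensor (zipWith _+₄_ zeros (zeros {m})) y     ≡⟨ tensor-+ˡ (zeros {m}) zeros y ⟩
  tensor (zeros {m}) y ⊕ tensor (zeros {m}) y   ≡⟨ ⊕-self _ ⟩
  𝟎                                             ∎
  where open ≡-Reasoning

-- Induction on the rows. The top row is `row 𝟙 y` for some `y`, realised by the first unit vector
-- tensored with `y`; the other rows come from the induction hypothesis for `H` restricted to
-- matrices with zero top row.
tensors-span : ∀ {m n} (H : Vec Block (m * n) → Set) → (∀ u v → H u → H v → H (u ⊕ v)) →
               (∀ x y → H (tensor {m} {n} x y)) → ∀ v → H v
tensors-span {zero}      H add ten [] = ten [] zeros
tensors-span {suc m} {n} H add ten v with splitAt n v
... | r , w , refl with row-𝟙-surjective r
... | y , refl = subst H
  (trans (zipWith-++ addBlock (row 𝟙 y) 𝟎 𝟎 w) (cong₂ _++ᵥ_ (⊕-identityʳ (row 𝟙 y)) (⊕-identityˡ w)))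
  (add _ _ head-row (tensors-span {m} {n} (λ w → H (𝟎 ++ᵥ w)) add-tail ten-tail w))
  where
  head-row : H (row 𝟙 y ++ᵥ 𝟎)
  head-row = subst (λ z → H (row 𝟙 y ++ᵥ z)) (tensor-zerosˡ {m} y) (ten (𝟙 ∷ zeros) y)

  add-tail : ∀ u v → H (𝟎 ++ᵥ u) → H (𝟎 ++ᵥ v) → H (𝟎 ++ᵥ (u ⊕ v))
  add-tail u v hu hv = subst H
    (trans (zipWith-++ addBlock 𝟎 u 𝟎 v) (cong (_++ᵥ (u ⊕ v)) (⊕-self 𝟎))) (add _ _ hu hv)

  ten-tail : ∀ x y → H (𝟎 ++ᵥ tensor x y)
  ten-tail x y = subst (λ z → H (z ++ᵥ tensor x y)) (row-𝟘 y) (ten (𝟘 ∷ x) y)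

-- Orbit representatives and the embedding of Q(5,2) ⊗ Q(5,2)

-- Conjugation inverts the nonzero elements of F₄, so scaling by this turns a nonzero leading
-- coordinate into `𝟙`.
normaliser : V → F₄
normaliser v = conj (lead v)

normaliser-correct : ∀ v → T (isQPoint v) → T (not (isZero₄ (normaliser v)))
  × T (isQPoint (normaliser v ·ᵥ v)) × T (isNormalised (normaliser v ·ᵥ v))
normaliser-correct (a ∷ b ∷ c ∷ []) = decided a b c
  where
  decided : ∀ a b c → let v = a ∷ b ∷ c ∷ [] in T (isQPoint v) → T (not (isZero₄ (normaliser v)))
    × T (isQPoint (normaliser v ·ᵥ v)) × T (isNormalised (normaliser v ·ᵥ v))
  -- Evaluation on all 64 vectors of `V`; every condition is a Boolean test.
  decided = decide (∀₄? λ a → ∀₄? λ b → ∀₄? λ c → let v = a ∷ b ∷ c ∷ [] in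
    T? (isQPoint v) →-dec (T? (not (isZero₄ (normaliser v)))
      ×-dec T? (isQPoint (normaliser v ·ᵥ v)) ×-dec T? (isNormalised (normaliser v ·ᵥ v))))

nonzero₄ : ∀ {k} → T (not (isZero₄ k)) → k ≢ 𝟘
nonzero₄ () refl

φ : TPoint → Vec Block 9
φ (((x , _) , (y , _)) , _) = tensor x y

-- One factor at a time: for normalised `x`, singular vectors span the second factor. A singular `x`
-- is then normalised by scaling both components, which fixes the tensor, and singular vectors span
-- the first factor too.
φ-spans : Spans (replicate 9 Q₈) φ
φ-spans H add pt = tensors-span {3} {3} H add tensors
  where
  normalised : ∀ x → T (isQPoint x) → T (isNormalised x) → ∀ y → H (tensor x y)
  normalised x p n = singular-spans (λ y → H (tensor x y))
    (λ y y′ h h′ → subst H (sym (tensor-+ʳ x y y′)) (add _ _ h h′))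
    (λ y q → pt (((x , p) , (y , q)) , n))

  tensors : ∀ x y → H (tensor x y)
  tensors x y = singular-spans (λ x → H (tensor x y))
    (λ x x′ h h′ → subst H (sym (tensor-+ˡ x x′ y)) (add _ _ h h′))
    (λ x p → let k≢0 , q , n = normaliser-correct x p ; k = normaliser x in
      subst H (tensor-scale k (nonzero₄ k≢0) x y) (normalised (k ·ᵥ x) q n (k ·ᵥ y)))
    x

-- Scale invariance lets the representatives be replaced by those lying on a product line; there one
-- component is constant and the tensor is additive in the other.
φ-line : ∀ p q r → TLine p q r → φ p ⊕ φ q ≡ φ r
φ-line (((x₁ , _) , (x₂ , _)) , _) (((y₁ , _) , (y₂ , _)) , _) (((z₁ , _) , (z₂ , _)) , _)
       (k , l , m , k≢0 , l≢0 , m≢0 , line)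
  rewrite sym (tensor-scale k k≢0 x₁ x₂) | sym (tensor-scale l l≢0 y₁ y₂) | sym (tensor-scale m m≢0 z₁ z₂)
  with line
... | inj₁ ((_ , e) , e₁ , e₂) rewrite sym e₂ | sym e₁ | sym e = sym (tensor-+ˡ (k ·ᵥ x₁) (l ·ᵥ y₁) (k ·ᵥ x₂))
... | inj₂ ((_ , e) , e₁ , e₂) rewrite sym e₂ | sym e₁ | sym e = sym (tensor-+ʳ (k ·ᵥ x₁) (k ·ᵥ x₂) (l ·ᵥ y₂))

-- After the same rescaling, the component shared by the two points is still singular, and its norm
-- is a factor of the cocycle.
β-φ-line : ∀ p q r → TLine p q r → β (replicate 9 Q₈) (φ p) (φ q) ≡ false
β-φ-line (((x₁ , p₁) , (x₂ , p₂)) , _) (((y₁ , _) , (y₂ , _)) , _) _ (k , l , _ , k≢0 , l≢0 , _ , line)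
  rewrite sym (tensor-scale k k≢0 x₁ x₂) | sym (tensor-scale l l≢0 y₁ y₂)
  with line
... | inj₁ (_ , e₁ , _) rewrite sym e₁ =
  βQ-tensor-sameʳ (k ·ᵥ x₁) (l ·ᵥ y₁) (k ·ᵥ x₂) (trans (norm-scale k k≢0 x₂) (singular x₂ p₂))
... | inj₂ (_ , e₁ , _) rewrite sym e₁ =
  trans (βQ-tensor-sameˡ (k ·ᵥ x₁) (k ·ᵥ x₂) (l ·ᵥ y₂))
        (cong (_∧ βQ (row 𝟙 (k ·ᵥ x₂)) (row 𝟙 (l ·ᵥ y₂))) (trans (norm-scale k k≢0 x₁) (singular x₁ p₁)))

Q52⊗Q52-representation : HasNonAbelianRepresentation (CentralProduct (replicate 9 Q₈)) Q52⊗Q52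
Q52⊗Q52-representation = liftRepresentation (replicate 9 Q₈) Q52⊗Q52 φ
  (λ { (((x , p) , (y , q)) , _) →
         nonvanishing⇒≢𝟎 (trans (vanishes-tensor x y) (cong₂ _∨_ (nonzero x p) (nonzero y q))) })
  (λ { (((x , p) , (y , q)) , _) → βQ-tensor-sameʳ x x y (singular y q) })
  φ-line β-φ-line φ-spans
  -- Again a commutator of involutions: its central coordinate is the trace of the Hermitian product
  -- of `φ g` and `φ h`, here Tr (ω²) = 1.
  ((g , false) ∷ (h , false) ∷ (g , false) ∷ (h , false) ∷ [] , refl)
  , (φ g , false) , (φ h , false) , λ ()
  where
  g h : TPoint
  g = ((𝟙 ∷ 𝟙 ∷ 𝟘 ∷ [] , _) , (𝟙 ∷ 𝟙 ∷ 𝟘 ∷ [] , _)) , _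
  h = ((𝟙 ∷ ω² ∷ 𝟘 ∷ [] , _) , (𝟙 ∷ 𝟘 ∷ 𝟙 ∷ [] , _)) , _

theorem1p1 : HasNonAbelianRepresentation (ExtraSpecial⁺ 6) Q52×L3
    × HasNonAbelianRepresentation (ExtraSpecial⁻ 9) Q52⊗Q52
theorem1p1 = Q52×L3-representation ,
  transport (replicate 9 Q₈) (Q₈ ∷ replicate 8 D₈) (θ-isGroupIsomorphism Q₈⁹≅2¹⁺¹⁸₋) Q52⊗Q52-representation
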